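{- Let $W_n$ be the wheel graph on $n\geq 4$ vertices, i.e. a cycle on $n-1$ vertices together with one additional vertex adjacent to all of them. Let $c_0:V(W_n)\to\mathbb{Z}$ be any initial chip configuration. Then the sequence of configurations $(c_t)_{t\ge0}$ produced by the diffusion process is eventually periodic, i.e. there exist $t\geq 0$ and $p\geq 1$ with $c_{t+p}=c_t$.
   Context: Diffusion process: for a finite simple graph $G$ and a chip configuration $c_t:V(G)\to\mathbb{Z}$ (negative values allowed), the next configuration is defined simultaneously for every vertex $u$ by $c_{t+1}(u)=c_t(u)-|\{w\in N(u): c_t(u)>c_t(w)\}|+|\{w\in N(u): c_t(u)<c_t(w)\}|$. -}

module Defs where

open import Data.Empty using (⊥)
open import Data.Fin using (Fin; zero; suc; toℕ)
open import Data.Integer using (ℤ; +_; _+_; _-_)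
open import Data.Integer.Properties using (_<?_)
open import Data.List using (List; allFin; filter; length)
open import Data.Nat as ℕ using (ℕ; zero; suc; s≤s; _≤_)
import Data.Nat.Properties as ℕ
open import Data.Product using (_×_; _,_)
open import Data.Sum using (_⊎_; inj₁; inj₂; swap)
open import Data.Unit using (⊤; tt)
open import Level using (0ℓ)
open import Relation.Binary using (Rel; Decidable; Symmetric; Irreflexive)
open import Relation.Binary.PropositionalEquality using (_≡_; refl)
open import Relation.Nullary using (¬_; yes; no)
open import Relation.Nullary.Decidable using (_×-dec_; _⊎-dec_)

record Graph (n : ℕ) : Set₁ where
  field
    Adj    : Rel (Fin n) 0ℓ
    adj?   : Decidable Adj
    symm   : Symmetric Adj
    irrefl : Irreflexive _≡_ Adj

  N : Fin n → List (Fin n)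
  N u = filter (adj? u) (allFin n)

open Graph public

Config : ℕ → Set
Config n = Fin n → ℤ

module _ {n : ℕ} (G : Graph n) where

  poorer : Config n → Fin n → List (Fin n)
  poorer c u = filter (λ w → c w <? c u) (N G u)

  richer : Config n → Fin n → List (Fin n)
  richer c u = filter (λ w → c u <? c w) (N G u)

  step : Config n → Config n
  step c u = c u - + length (poorer c u) + + length (richer c u)

  diffusion : Config n → ℕ → Config n
  diffusion c₀ zero    = c₀
  diffusion c₀ (suc t) = step (diffusion c₀ t)

-- Next i j: j follows i in the cyclic order 0, 1, …, m-1, 0.
Next : ∀ {m} → Rel (Fin m) 0ℓ
Next {m} i j = (suc (toℕ i) ≡ toℕ j) ⊎ (suc (toℕ i) ≡ m × toℕ j ≡ 0)

next? : ∀ {m} → Decidable (Next {m})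
next? {m} i j =
  (suc (toℕ i) ℕ.≟ toℕ j) ⊎-dec ((suc (toℕ i) ℕ.≟ m) ×-dec (toℕ j ℕ.≟ 0))

next-irrefl : ∀ {m} → 3 ≤ m → (i : Fin m) → ¬ Next i i
next-irrefl _ i (inj₁ eq) = ℕ.1+n≢n eq
next-irrefl (s≤s (s≤s _)) zero    (inj₂ (() , _))
next-irrefl _             (suc _) (inj₂ (_ , ()))

cycle : ∀ m → 3 ≤ m → Graph m
cycle m 3≤m = record
  { Adj    = λ i j → Next i j ⊎ Next j i
  ; adj?   = λ i j → next? i j ⊎-dec next? j i
  ; symm   = swap
  ; irrefl = λ { {i} refl (inj₁ p) → next-irrefl 3≤m i p
               ; {i} refl (inj₂ p) → next-irrefl 3≤m i p }
  }

-- The cone adds to G a new vertex, zero, adjacent to every vertex of G.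
module _ {m : ℕ} (G : Graph m) where

  ConeAdj : Rel (Fin (suc m)) 0ℓ
  ConeAdj zero    zero    = ⊥
  ConeAdj zero    (suc _) = ⊤
  ConeAdj (suc _) zero    = ⊤
  ConeAdj (suc i) (suc j) = Adj G i j

  coneAdj? : Decidable ConeAdj
  coneAdj? zero    zero    = no λ ()
  coneAdj? zero    (suc _) = yes tt
  coneAdj? (suc _) zero    = yes tt
  coneAdj? (suc i) (suc j) = adj? G i j

  coneSymm : Symmetric ConeAdj
  coneSymm {zero}  {suc _} _ = tt
  coneSymm {suc _} {zero}  _ = tt
  coneSymm {suc _} {suc _} p = symm G p

  coneIrrefl : Irreflexive _≡_ ConeAdj
  coneIrrefl {zero}  refl ()
  coneIrrefl {suc _} refl p = irrefl G refl p

  cone : Graph (suc m)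
  cone = record
    { Adj    = ConeAdj
    ; adj?   = coneAdj?
    ; symm   = λ {i} {j} → coneSymm {i} {j}
    ; irrefl = λ {i} {j} → coneIrrefl {i} {j}
    }

wheel : ∀ n → 4 ≤ n → Graph n
wheel (suc m) (s≤s 3≤m) = cone (cycle m 3≤m)

{-# OPTIONS --safe #-}

-- Let V(c) = Σ c(u)². A step adds to c(u) the net amount F(u) received from its
-- neighbours, and since each edge carries one chip downhill, V changes by
-- Σ F(u)² - 2 Σ |c(u) - c(w)|, the last sum being over the edges.
-- The first sum is at most n³, so V cannot increase once some vertex differs from
-- the hub by more than n³. In the remaining configurations all vertices are close
-- to the hub and the total number of chips is conserved, so V is bounded there.
-- Hence V is bounded along the orbit, which therefore visits finitely many
-- configurations.
module Submission where

open import Data.Bool using (true; false; if_then_else_)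
open import Data.Fin using (Fin; zero; suc; toℕ; fromℕ<; funToFin; finToFun)
open import Data.Fin.Properties
  using (all?; ¬∀⟶∃¬; pigeonhole; finToFun-funToFin; fromℕ<-injective)
open import Data.Integer as ℤ using (ℤ; +_; -[1+_]; 0ℤ; 1ℤ; ∣_∣)
import Data.Integer.Properties as ℤ
open import Data.Integer.Tactic.RingSolver using (solve-∀)
open import Data.List using (tabulate; filter; length)
open import Data.Nat as ℕ using (ℕ; suc; _+_; _≤_; s≤s; z≤n)
import Data.Nat.Properties as ℕ
open import Data.Product using (∃-syntax; _×_; _,_)
open import Data.Sum using (_⊎_; inj₁; inj₂)
open import Data.Unit using (tt)
open import Function using (_∘_; id; mk⇔)
open import Relation.Binary using (tri<; tri≈; tri>)
open import Relation.Binary.PropositionalEquality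
open import Relation.Nullary using (Dec; does; yes; no; ¬_; contradiction)
open import Relation.Nullary.Decidable using (_×-dec_; does-⇔; dec-true; dec-false)
open import Relation.Unary using (Pred) renaming (Decidable to Decidable₁)
open import Algebra.Properties.Semiring.Sum ℤ.+-*-semiring
  using (sum; sum-cong-≗; ∑-distrib-+; ∑-comm; *-distribˡ-sum)
open import Algebra.Properties.AbelianGroup ℤ.+-0-abelianGroup
  using () renaming (∙-cancelʳ to +-cancelʳ)
open import Defs

-- Finite sums of integers and bounds on absolute values.

sum-neg : ∀ {n} (f : Fin n → ℤ) → sum (λ i → ℤ.- f i) ≡ ℤ.- sum f
sum-neg {ℕ.zero} f = refl
sum-neg {suc n}  f = trans
  (cong (ℤ._+_ (ℤ.- f zero)) (sum-neg (f ∘ suc)))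
  (sym (ℤ.neg-distrib-+ (f zero) (sum (f ∘ suc))))

∑-distrib-- : ∀ {n} (f g : Fin n → ℤ) → sum (λ i → f i ℤ.- g i) ≡ sum f ℤ.- sum g
∑-distrib-- f g = trans (∑-distrib-+ f (λ i → ℤ.- g i)) (cong (ℤ._+_ (sum f)) (sum-neg g))

sum-const : ∀ n (x : ℤ) → sum {n} (λ _ → x) ≡ + n ℤ.* x
sum-const ℕ.zero  x = refl
sum-const (suc n) x = trans (cong (ℤ._+_ x) (sum-const n x)) (sym (ℤ.suc-* (+ n) x))

sum-nonneg : ∀ {n} (f : Fin n → ℤ) → (∀ i → 0ℤ ℤ.≤ f i) → 0ℤ ℤ.≤ sum f
sum-nonneg {ℕ.zero} f f≥0 = ℤ.≤-refl
sum-nonneg {suc n}  f f≥0 = ℤ.+-mono-≤ (f≥0 zero) (sum-nonneg (f ∘ suc) (f≥0 ∘ suc))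

term≤sum : ∀ {n} (f : Fin n → ℤ) → (∀ i → 0ℤ ℤ.≤ f i) → ∀ i → f i ℤ.≤ sum f
term≤sum f f≥0 zero = subst (ℤ._≤ sum f) (ℤ.+-identityʳ (f zero))
  (ℤ.+-monoʳ-≤ (f zero) (sum-nonneg (f ∘ suc) (f≥0 ∘ suc)))
term≤sum f f≥0 (suc i) = subst (ℤ._≤ sum f) (ℤ.+-identityˡ (f (suc i)))
  (ℤ.+-mono-≤ (f≥0 zero) (term≤sum (f ∘ suc) (f≥0 ∘ suc) i))

∣sum∣≤ : ∀ {n} (f : Fin n → ℤ) k → (∀ i → ∣ f i ∣ ≤ k) → ∣ sum f ∣ ≤ n ℕ.* k
∣sum∣≤ {ℕ.zero} f k f≤k = z≤n
∣sum∣≤ {suc n}  f k f≤k = ℕ.≤-trans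
  (ℤ.∣i+j∣≤∣i∣+∣j∣ (f zero) (sum (f ∘ suc)))
  (ℕ.+-mono-≤ (f≤k zero) (∣sum∣≤ (f ∘ suc) k (f≤k ∘ suc)))

i≤+∣i∣ : ∀ i → i ℤ.≤ + ∣ i ∣
i≤+∣i∣ (+ n)    = ℤ.≤-refl
i≤+∣i∣ -[1+ n ] = ℤ.-≤+

square≡+ : ∀ i → i ℤ.* i ≡ + (∣ i ∣ ℕ.* ∣ i ∣)
square≡+ (+ n)    = sym (ℤ.pos-* n n)
square≡+ -[1+ n ] = refl

square≥0 : ∀ i → 0ℤ ℤ.≤ i ℤ.* i
square≥0 i = subst (0ℤ ℤ.≤_) (sym (square≡+ i)) (ℤ.+≤+ z≤n)

n≤n*n : ∀ n → n ≤ n ℕ.* n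
n≤n*n ℕ.zero  = z≤n
n≤n*n (suc n) = ℕ.m≤m*n (suc n) (suc n)

∣square∣≤ : ∀ i {k} → ∣ i ∣ ≤ k → ∣ i ℤ.* i ∣ ≤ k ℕ.* k
∣square∣≤ i i≤k = subst (_≤ _) (sym (ℤ.abs-* i i)) (ℕ.*-mono-≤ i≤k i≤k)

-- Summing the deviations `f i - f h` expresses `n` times `f h` as the total minus the sum of the
-- deviations. This turns a conserved total into a bound on the hub's value.
∣centre∣≤ : ∀ {n} (f : Fin n → ℤ) h {k} → (∀ i → ∣ f i ℤ.- f h ∣ ≤ k) →
            ∣ f h ∣ ≤ ∣ sum f ∣ + n ℕ.* k
∣centre∣≤ {suc n} f h {k} near = begin
  ∣ f h ∣                                     ≤⟨ ℕ.m≤n*m ∣ f h ∣ (suc n) ⟩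
  suc n ℕ.* ∣ f h ∣                           ≡⟨ ℤ.abs-* (+ suc n) (f h) ⟨
  ∣ + suc n ℤ.* f h ∣                         ≡⟨ cong ∣_∣ split ⟩
  ∣ sum f ℤ.- sum dev ∣                       ≤⟨ ℤ.∣i-j∣≤∣i∣+∣j∣ (sum f) (sum dev) ⟩
  ∣ sum f ∣ + ∣ sum dev ∣                     ≤⟨ ℕ.+-monoʳ-≤ ∣ sum f ∣ (∣sum∣≤ dev k near) ⟩
  ∣ sum f ∣ + suc n ℕ.* k                     ∎
  where
  open ℕ.≤-Reasoning
  dev : Fin (suc n) → ℤ
  dev i = f i ℤ.- f h
  cancel : ∀ a b → b ≡ a ℤ.- (a ℤ.- b)
  cancel = solve-∀
  split : + suc n ℤ.* f h ≡ sum f ℤ.- sum dev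
  split = trans (cancel (sum f) (+ suc n ℤ.* f h)) (cong (ℤ._-_ (sum f))
    (sym (trans (∑-distrib-- f (λ _ → f h)) (cong (ℤ._-_ (sum f)) (sum-const (suc n) (f h))))))

∣i∣≤∣i-j∣+∣j∣ : ∀ i j → ∣ i ∣ ≤ ∣ i ℤ.- j ∣ + ∣ j ∣
∣i∣≤∣i-j∣+∣j∣ i j = subst (λ k → ∣ k ∣ ≤ ∣ i ℤ.- j ∣ + ∣ j ∣) (cancel i j)
  (ℤ.∣i+j∣≤∣i∣+∣j∣ (i ℤ.- j) j)
  where
  cancel : ∀ i j → i ℤ.- j ℤ.+ j ≡ i
  cancel = solve-∀

-- Counting by sums of indicators.

-- Only the boolean `does d` enters, so equivalent decidable propositions have equal indicators
-- whatever their proofs.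
𝟙 : ∀ {a} {A : Set a} → Dec A → ℤ
𝟙 d = if does d then 1ℤ else 0ℤ

∣𝟙-𝟙∣≤1 : ∀ {a b} {A : Set a} {B : Set b} (d : Dec A) (e : Dec B) → ∣ 𝟙 d ℤ.- 𝟙 e ∣ ≤ 1
∣𝟙-𝟙∣≤1 d e with does d | does e
... | true  | true  = z≤n
... | true  | false = s≤s z≤n
... | false | true  = s≤s z≤n
... | false | false = z≤n

-- The nested filters are those of `poorer` and `richer` once `N` is unfolded. A general `f` lets
-- the induction pass to `f ∘ suc`; `allFin` is the case `f = id`.
length-filter : ∀ {n p q a} {A : Set a} {P : Pred A p} {Q : Pred A q}
  (P? : Decidable₁ P) (Q? : Decidable₁ Q) (f : Fin n → A) →
  + length (filter P? (filter Q? (tabulate f))) ≡ sum (λ i → 𝟙 (Q? (f i) ×-dec P? (f i)))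
length-filter {ℕ.zero} P? Q? f = refl
length-filter {suc n}  P? Q? f with does (Q? (f zero))
... | false = trans (length-filter P? Q? (f ∘ suc)) (sym (ℤ.+-identityˡ _))
... | true with does (P? (f zero))
...   | false = trans (length-filter P? Q? (f ∘ suc)) (sym (ℤ.+-identityˡ _))
...   | true  = cong (ℤ._+_ 1ℤ) (length-filter P? Q? (f ∘ suc))

-- Diffusion as an antisymmetric flow, and conservation of chips.

module _ {n : ℕ} (G : Graph n) where

  -- The chip, if any, that `u` receives from `w`.
  gain : Config n → Fin n → Fin n → ℤ
  gain c u w = 𝟙 (adj? G u w ×-dec c u ℤ.<? c w)

  flow : Config n → Fin n → Fin n → ℤ
  flow c u w = gain c u w ℤ.- gain c w u

  netGain : Config n → Fin n → ℤ
  netGain c u = sum (flow c u)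

  step≡ : ∀ c u → step G c u ≡ c u ℤ.+ netGain c u
  step≡ c u = begin
    c u ℤ.- + length (poorer G c u) ℤ.+ + length (richer G c u)
      ≡⟨ cong₂ (λ x y → c u ℤ.- x ℤ.+ y)
           (trans (length-filter (λ w → c w ℤ.<? c u) (adj? G u) id) (sum-cong-≗ swapped))
           (length-filter (λ w → c u ℤ.<? c w) (adj? G u) id) ⟩
    c u ℤ.- sum (λ w → gain c w u) ℤ.+ sum (gain c u)
      ≡⟨ reorder (c u) (sum (λ w → gain c w u)) (sum (gain c u)) ⟩
    c u ℤ.+ (sum (gain c u) ℤ.- sum (λ w → gain c w u))
      ≡⟨ cong (ℤ._+_ (c u)) (∑-distrib-- (gain c u) (λ w → gain c w u)) ⟨
    c u ℤ.+ netGain c u ∎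
    where
    open ≡-Reasoning
    reorder : ∀ a b d → a ℤ.- b ℤ.+ d ≡ a ℤ.+ (d ℤ.- b)
    reorder = solve-∀
    -- By symmetry of adjacency, a chip that `u` loses to `w` is one that `w` gains from `u`.
    swapped : ∀ w → 𝟙 (adj? G u w ×-dec c w ℤ.<? c u) ≡ gain c w u
    swapped w = cong (if_then 1ℤ else 0ℤ) (does-⇔
      (mk⇔ (λ (a , l) → symm G a , l) (λ (a , l) → symm G a , l))
      (adj? G u w ×-dec c w ℤ.<? c u) (adj? G w u ×-dec c w ℤ.<? c u))

  -- Every chip gained is lost elsewhere: exchanging the two summations makes total gain and total
  -- loss the same double sum.
  sum-netGain : ∀ c → sum (netGain c) ≡ 0ℤ
  sum-netGain c = begin
    sum (netGain c)
      ≡⟨ sum-cong-≗ (λ u → ∑-distrib-- (gain c u) (λ w → gain c w u)) ⟩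
    sum (λ u → sum (gain c u) ℤ.- sum (λ w → gain c w u))
      ≡⟨ ∑-distrib-- (λ u → sum (gain c u)) (λ u → sum (λ w → gain c w u)) ⟩
    sum (λ u → sum (gain c u)) ℤ.- sum (λ u → sum (λ w → gain c w u))
      ≡⟨ ℤ.i≡j⇒i-j≡0 (∑-comm (gain c)) ⟩
    0ℤ ∎
    where open ≡-Reasoning

  sum-step : ∀ c → sum (step G c) ≡ sum c
  sum-step c = begin
    sum (step G c)              ≡⟨ sum-cong-≗ (step≡ c) ⟩
    sum (λ u → c u ℤ.+ netGain c u) ≡⟨ ∑-distrib-+ c (netGain c) ⟩
    sum c ℤ.+ sum (netGain c)   ≡⟨ cong (ℤ._+_ (sum c)) (sum-netGain c) ⟩
    sum c ℤ.+ 0ℤ                ≡⟨ ℤ.+-identityʳ (sum c) ⟩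
    sum c                       ∎
    where open ≡-Reasoning

  sum-diffusion : ∀ c t → sum (diffusion G c t) ≡ sum c
  sum-diffusion c ℕ.zero  = refl
  sum-diffusion c (suc t) = trans (sum-step (diffusion G c t)) (sum-diffusion c t)

  -- Energy and its change in one step.

  energy : Config n → ℤ
  energy c = sum (λ u → c u ℤ.* c u)

  -- On an edge, `flow c w u` is the sign of `c u - c w`, so this is the absolute difference; off
  -- the edges it vanishes. The product form is what lets `drop≡` expand it.
  edgeDrop : Config n → Fin n → Fin n → ℤ
  edgeDrop c u w = (c u ℤ.- c w) ℤ.* flow c w u

  -- Ordered pairs are summed, so each edge counts twice; this supplies the factor 2 in the energy
  -- change.
  drop : Config n → ℤ
  drop c = sum (λ u → sum (edgeDrop c u))

  gain-adj : ∀ c {u w} → Adj G u w → c u ℤ.< c w → gain c u w ≡ 1ℤ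
  gain-adj c {u} {w} a l = cong (if_then 1ℤ else 0ℤ)
    (dec-true (adj? G u w ×-dec c u ℤ.<? c w) (a , l))

  gain-≮ : ∀ c u w → ¬ c u ℤ.< c w → gain c u w ≡ 0ℤ
  gain-≮ c u w ≮ = cong (if_then 1ℤ else 0ℤ)
    (dec-false (adj? G u w ×-dec c u ℤ.<? c w) (λ (_ , l) → ≮ l))

  gain-≁ : ∀ c u w → ¬ Adj G u w → gain c u w ≡ 0ℤ
  gain-≁ c u w ≁ = cong (if_then 1ℤ else 0ℤ)
    (dec-false (adj? G u w ×-dec c u ℤ.<? c w) (λ (a , _) → ≁ a))

  ∣c-c∣≤edgeDrop : ∀ c u w → Adj G u w → + ∣ c u ℤ.- c w ∣ ℤ.≤ edgeDrop c u w
  ∣c-c∣≤edgeDrop c u w a with ℤ.<-cmp (c u) (c w)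
  ... | tri< l _ g = ℤ.≤-reflexive (begin
    + ∣ c u ℤ.- c w ∣             ≡⟨ cong +_ (ℤ.∣i-j∣≡∣j-i∣ (c u) (c w)) ⟩
    + ∣ c w ℤ.- c u ∣             ≡⟨ ℤ.0≤i⇒+∣i∣≡i (ℤ.i≤j⇒0≤j-i (ℤ.<⇒≤ l)) ⟩
    c w ℤ.- c u                   ≡⟨ flip (c u) (c w) ⟩
    (c u ℤ.- c w) ℤ.* (0ℤ ℤ.- 1ℤ) ≡⟨ cong₂ (λ x y → (c u ℤ.- c w) ℤ.* (x ℤ.- y))
                                       (gain-≮ c w u g) (gain-adj c a l) ⟨
    edgeDrop c u w                ∎)
    where
    open ≡-Reasoning
    flip : ∀ x y → y ℤ.- x ≡ (x ℤ.- y) ℤ.* (0ℤ ℤ.- 1ℤ)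
    flip = solve-∀
  ... | tri> l _ g = ℤ.≤-reflexive (begin
    + ∣ c u ℤ.- c w ∣             ≡⟨ ℤ.0≤i⇒+∣i∣≡i (ℤ.i≤j⇒0≤j-i (ℤ.<⇒≤ g)) ⟩
    c u ℤ.- c w                   ≡⟨ ℤ.*-identityʳ (c u ℤ.- c w) ⟨
    (c u ℤ.- c w) ℤ.* (1ℤ ℤ.- 0ℤ) ≡⟨ cong₂ (λ x y → (c u ℤ.- c w) ℤ.* (x ℤ.- y))
                                       (gain-adj c (symm G a) g) (gain-≮ c u w l) ⟨
    edgeDrop c u w                ∎)
    where open ≡-Reasoning
  ... | tri≈ _ e _ rewrite ℤ.i≡j⇒i-j≡0 e = ℤ.≤-refl

  edgeDrop≥0 : ∀ c u w → 0ℤ ℤ.≤ edgeDrop c u w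
  edgeDrop≥0 c u w = split (adj? G u w)
    where
    split : Dec (Adj G u w) → 0ℤ ℤ.≤ edgeDrop c u w
    split (yes a) = ℤ.≤-trans (ℤ.+≤+ z≤n) (∣c-c∣≤edgeDrop c u w a)
    split (no ≁)  = ℤ.≤-reflexive (sym (trans
      (cong₂ (λ x y → (c u ℤ.- c w) ℤ.* (x ℤ.- y))
        (gain-≁ c w u (≁ ∘ symm G)) (gain-≁ c u w ≁))
      (ℤ.*-zeroʳ (c u ℤ.- c w))))

  drop≥0 : ∀ c → 0ℤ ℤ.≤ drop c
  drop≥0 c = sum-nonneg _ λ u → sum-nonneg _ (edgeDrop≥0 c u)

  ∣c-c∣≤drop : ∀ c u w → Adj G u w → + ∣ c u ℤ.- c w ∣ ℤ.≤ drop c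
  ∣c-c∣≤drop c u w a = ℤ.≤-trans (∣c-c∣≤edgeDrop c u w a) (ℤ.≤-trans
    (term≤sum (edgeDrop c u) (edgeDrop≥0 c u) w)
    (term≤sum (λ v → sum (edgeDrop c v)) (λ v → sum-nonneg _ (edgeDrop≥0 c v)) u))

  -- Summation by parts: each term splits into one contribution from each endpoint, and after
  -- exchanging summations both halves equal `P`. Hence `drop c` is minus the cross term of the
  -- expanded squares.
  drop≡ : ∀ c → let P = sum (λ u → c u ℤ.* netGain c u) in drop c ≡ ℤ.- (P ℤ.+ P)
  drop≡ c = begin
    sum (λ u → sum (edgeDrop c u))
      ≡⟨ sum-cong-≗ (λ u → trans (sum-cong-≗ (λ w →
           expand (c u) (c w) (gain c u w) (gain c w u))) (sum-neg (λ w → A u w ℤ.+ A w u))) ⟩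
    sum (λ u → ℤ.- sum (λ w → A u w ℤ.+ A w u))
      ≡⟨ sum-neg (λ u → sum (λ w → A u w ℤ.+ A w u)) ⟩
    ℤ.- sum (λ u → sum (λ w → A u w ℤ.+ A w u))
      ≡⟨ cong ℤ.-_ (trans (sum-cong-≗ (λ u → ∑-distrib-+ (A u) (λ w → A w u)))
           (∑-distrib-+ (λ u → sum (A u)) (λ u → sum (λ w → A w u)))) ⟩
    ℤ.- (sum (λ u → sum (A u)) ℤ.+ sum (λ u → sum (λ w → A w u)))
      ≡⟨ cong (λ x → ℤ.- (sum (λ u → sum (A u)) ℤ.+ x)) (∑-comm A) ⟨
    ℤ.- (sum (λ u → sum (A u)) ℤ.+ sum (λ u → sum (A u)))
      ≡⟨ cong (λ x → ℤ.- (x ℤ.+ x)) (sum-cong-≗ (λ u → *-distribˡ-sum (c u) (flow c u))) ⟨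
    ℤ.- (P ℤ.+ P) ∎
    where
    open ≡-Reasoning
    P : ℤ
    P = sum (λ u → c u ℤ.* netGain c u)
    A : Fin n → Fin n → ℤ
    A u w = c u ℤ.* flow c u w
    expand : ∀ x y g k → (x ℤ.- y) ℤ.* (k ℤ.- g) ≡ ℤ.- (x ℤ.* (g ℤ.- k) ℤ.+ y ℤ.* (k ℤ.- g))
    expand = solve-∀

  energy-step : ∀ c → energy (step G c) ≡
    energy c ℤ.+ (sum (λ u → netGain c u ℤ.* netGain c u) ℤ.- drop c)
  energy-step c = begin
    sum (λ u → step G c u ℤ.* step G c u)
      ≡⟨ sum-cong-≗ (λ u → trans (cong (λ x → x ℤ.* x) (step≡ c u)) (square (c u) (F u))) ⟩
    sum (λ u → c u ℤ.* c u ℤ.+ (F u ℤ.* F u ℤ.+ (c u ℤ.* F u ℤ.+ c u ℤ.* F u)))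
      ≡⟨ ∑-distrib-+ (λ u → c u ℤ.* c u) _ ⟩
    energy c ℤ.+ sum (λ u → F u ℤ.* F u ℤ.+ (c u ℤ.* F u ℤ.+ c u ℤ.* F u))
      ≡⟨ cong (ℤ._+_ (energy c)) (trans (∑-distrib-+ (λ u → F u ℤ.* F u) _)
           (cong (ℤ._+_ Q) (∑-distrib-+ (λ u → c u ℤ.* F u) _))) ⟩
    energy c ℤ.+ (Q ℤ.+ (P ℤ.+ P))
      ≡⟨ cong (λ x → energy c ℤ.+ (Q ℤ.+ x)) (trans (cong ℤ.-_ (drop≡ c)) (ℤ.neg-involutive _)) ⟨
    energy c ℤ.+ (Q ℤ.- drop c) ∎
    where
    open ≡-Reasoning
    F : Fin n → ℤ
    F = netGain c
    P Q : ℤ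
    P = sum (λ u → c u ℤ.* F u)
    Q = sum (λ u → F u ℤ.* F u)
    square : ∀ x f → (x ℤ.+ f) ℤ.* (x ℤ.+ f) ≡ x ℤ.* x ℤ.+ (f ℤ.* f ℤ.+ (x ℤ.* f ℤ.+ x ℤ.* f))
    square = solve-∀

  -- This is `n` cubed: each `flow` is at most 1 in absolute value, so each net gain is at most
  -- `n * 1`, and `n` squares are summed.
  maxRise : ℕ
  maxRise = n ℕ.* (n ℕ.* 1 ℕ.* (n ℕ.* 1))

  sum-netGain²≤ : ∀ c → sum (λ u → netGain c u ℤ.* netGain c u) ℤ.≤ + maxRise
  sum-netGain²≤ c = ℤ.≤-trans (i≤+∣i∣ _) (ℤ.+≤+ (∣sum∣≤ _ (n ℕ.* 1 ℕ.* (n ℕ.* 1)) λ u →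
    ∣square∣≤ (netGain c u) (∣sum∣≤ (flow c u) 1 λ w → ∣𝟙-𝟙∣≤1
      (adj? G u w ×-dec c u ℤ.<? c w) (adj? G w u ×-dec c w ℤ.<? c u))))

  energy-step≤ : ∀ c → energy (step G c) ℤ.≤ energy c ℤ.+ + maxRise
  energy-step≤ c = subst (ℤ._≤ energy c ℤ.+ + maxRise) (sym (energy-step c))
    (ℤ.+-monoʳ-≤ (energy c) (ℤ.≤-trans
      (ℤ.+-mono-≤ (sum-netGain²≤ c) (ℤ.neg-mono-≤ (drop≥0 c)))
      (ℤ.≤-reflexive (ℤ.+-identityʳ (+ maxRise)))))

  -- One such edge alone makes `drop c` at least `maxRise`, which outweighs the sum of the squared
  -- net gains.
  energy-step-far : ∀ c u w → Adj G u w → maxRise ≤ ∣ c u ℤ.- c w ∣ →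
                    energy (step G c) ℤ.≤ energy c
  energy-step-far c u w a far = subst₂ ℤ._≤_ (sym (energy-step c)) (ℤ.+-identityʳ (energy c))
    (ℤ.+-monoʳ-≤ (energy c) (ℤ.i≤j⇒i-j≤0 (ℤ.≤-trans (sum-netGain²≤ c)
      (ℤ.≤-trans (ℤ.+≤+ far) (∣c-c∣≤drop c u w a)))))

  ∣c∣≤energy : ∀ c {b} → energy c ℤ.≤ + b → ∀ u → ∣ c u ∣ ≤ b
  ∣c∣≤energy c {b} e≤b u = ℕ.≤-trans (n≤n*n ∣ c u ∣) (ℤ.drop‿+≤+
    (subst (ℤ._≤ + b) (square≡+ (c u))
      (ℤ.≤-trans (term≤sum (λ v → c v ℤ.* c v) (λ v → square≥0 (c v)) u) e≤b)))

  -- Bounded energy for graphs with a universal vertex.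

  Universal : Fin n → Set
  Universal h = ∀ u → u ≡ h ⊎ Adj G u h

  module _ {h : Fin n} (universal : Universal h) (c₀ : Config n) where

    -- Bounds every entry of a configuration close to the hub: the distance to the hub plus the
    -- bound on the hub from `∣centre∣≤`.
    radius : ℕ
    radius = maxRise + (∣ sum c₀ ∣ + n ℕ.* maxRise)

    -- Covers both the initial energy and the largest near-hub energy followed by one rise; a sum
    -- serves in place of a maximum.
    bound : ℕ
    bound = ∣ energy c₀ ∣ + (n ℕ.* (radius ℕ.* radius) + maxRise)

    energy-near : ∀ c → sum c ≡ sum c₀ → (∀ u → ∣ c u ℤ.- c h ∣ ≤ maxRise) →
                  energy c ℤ.≤ + (n ℕ.* (radius ℕ.* radius))
    energy-near c c≡ near = ℤ.≤-trans (i≤+∣i∣ _) (ℤ.+≤+ (∣sum∣≤ _ _ λ u →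
      ∣square∣≤ (c u) (ℕ.≤-trans (∣i∣≤∣i-j∣+∣j∣ (c u) (c h))
        (ℕ.+-mono-≤ (near u) (subst (λ s → ∣ c h ∣ ≤ ∣ s ∣ + n ℕ.* maxRise) c≡
          (∣centre∣≤ c h near))))))

    energy-bounded : ∀ t → energy (diffusion G c₀ t) ℤ.≤ + bound
    energy-bounded ℕ.zero  = ℤ.≤-trans (i≤+∣i∣ _) (ℤ.+≤+ (ℕ.m≤m+n _ _))
    energy-bounded (suc t) with diffusion G c₀ t | sum-diffusion c₀ t | energy-bounded t
    ... | c | c≡ | ih with all? (λ u → ∣ c u ℤ.- c h ∣ ℕ.≤? maxRise)
    -- Here the energy is bounded by conservation alone, so the induction hypothesis is not called
    -- upon and rises cannot accumulate.
    ...   | yes near = ℤ.≤-trans (energy-step≤ c) (ℤ.≤-trans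
            (ℤ.+-monoˡ-≤ (+ maxRise) (energy-near c c≡ near))
            (ℤ.+≤+ (ℕ.m≤n+m _ ∣ energy c₀ ∣)))
    ...   | no ¬near with ¬∀⟶∃¬ n _ (λ u → ∣ c u ℤ.- c h ∣ ℕ.≤? maxRise) ¬near
    ...     | u , far with universal u
    ...       | inj₂ a    = ℤ.≤-trans (energy-step-far c u h a (ℕ.≰⇒≥ far)) ih
    -- The hub is at distance 0 from itself, so the far vertex is a neighbour of the hub.
    ...       | inj₁ refl = contradiction
                (subst (λ x → ∣ x ∣ ≤ maxRise) (sym (ℤ.+-inverseʳ (c u))) z≤n) far

    diffusion-bounded : ∀ t u → ∣ diffusion G c₀ t u ∣ ≤ bound
    diffusion-bounded t = ∣c∣≤energy (diffusion G c₀ t) (energy-bounded t)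

-- From boundedness to recurrence.

-- Shifting by `b` moves the interval from `-b` to `b` onto 0 to `2b`, where taking the absolute
-- value loses nothing.
toFin : ∀ {b} i → ∣ i ∣ ≤ b → Fin (suc (b + b))
toFin {b} i i≤b = fromℕ< {∣ i ℤ.+ + b ∣}
  (s≤s (ℕ.≤-trans (ℤ.∣i+j∣≤∣i∣+∣j∣ i (+ b)) (ℕ.+-monoˡ-≤ b i≤b)))

0≤i+b : ∀ {b} i → ∣ i ∣ ≤ b → 0ℤ ℤ.≤ i ℤ.+ + b
0≤i+b (+ n)    _   = ℤ.+≤+ z≤n
0≤i+b {b} -[1+ n ] n<b = subst (0ℤ ℤ.≤_) (sym (ℤ.⊖-≥ n<b)) (ℤ.+≤+ z≤n)

toFin-injective : ∀ {b} i j (i≤b : ∣ i ∣ ≤ b) (j≤b : ∣ j ∣ ≤ b) →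
                  toFin i i≤b ≡ toFin j j≤b → i ≡ j
toFin-injective {b} i j i≤b j≤b eq = +-cancelʳ (+ b) i j (begin
  i ℤ.+ + b         ≡⟨ ℤ.0≤i⇒+∣i∣≡i (0≤i+b i i≤b) ⟨
  + ∣ i ℤ.+ + b ∣   ≡⟨ cong +_ (fromℕ<-injective _ _ _ _ eq) ⟩
  + ∣ j ℤ.+ + b ∣   ≡⟨ ℤ.0≤i⇒+∣i∣≡i (0≤i+b j j≤b) ⟩
  j ℤ.+ + b         ∎)
  where open ≡-Reasoning

bounded⇒recurrent : ∀ {n} (x : ℕ → Config n) b → (∀ t u → ∣ x t u ∣ ≤ b) →
                    ∃[ t ] ∃[ p ] (1 ≤ p × x (t + p) ≗ x t)
bounded⇒recurrent {n} x b x≤b =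
  -- A configuration is coded as an `n`-digit number in base `2b + 1`; one more time than there are
  -- codes forces a repetition.
  let i , j , i<j , eq = pigeonhole (ℕ.n<1+n (suc (b + b) ℕ.^ n)) (code ∘ toℕ) in
    toℕ i , toℕ j ℕ.∸ toℕ i , ℕ.m<n⇒0<n∸m i<j ,
    subst (λ t → x t ≗ x (toℕ i)) (sym (ℕ.m+[n∸m]≡n (ℕ.<⇒≤ i<j))) (code-injective (sym eq))
  where
  digits : ℕ → Fin n → Fin (suc (b + b))
  digits t u = toFin (x t u) (x≤b t u)
  code : ℕ → Fin (suc (b + b) ℕ.^ n)
  code t = funToFin (digits t)
  code-injective : ∀ {s t} → code s ≡ code t → x s ≗ x t
  code-injective {s} {t} eq u = toFin-injective (x s u) (x t u) (x≤b s u) (x≤b t u) (begin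
    digits s u             ≡⟨ finToFun-funToFin (digits s) u ⟨
    finToFun (code s) u    ≡⟨ cong (λ k → finToFun k u) eq ⟩
    finToFun (code t) u    ≡⟨ finToFun-funToFin (digits t) u ⟩
    digits t u             ∎)
    where open ≡-Reasoning

-- Periodicity, and the wheel as a cone with its apex as hub.

universal⇒periodic : ∀ {n} (G : Graph n) {h} → Universal G h → (c₀ : Config n) →
  ∃[ t ] ∃[ p ] (1 ≤ p × diffusion G c₀ (t + p) ≗ diffusion G c₀ t)
universal⇒periodic G universal c₀ =
  bounded⇒recurrent (diffusion G c₀) (bound G universal c₀) (diffusion-bounded G universal c₀)

cone-universal : ∀ {m} (G : Graph m) → Universal (cone G) zero
cone-universal G zero    = inj₁ refl
cone-universal G (suc _) = inj₂ tt

theorem9 : ∀ (n : ℕ) (4≤n : 4 ≤ n) (c₀ : Config n) →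
    ∃[ t ] ∃[ p ] (1 ≤ p ×
    diffusion (wheel n 4≤n) c₀ (t + p) ≗ diffusion (wheel n 4≤n) c₀ t)
theorem9 (suc m) (s≤s 3≤m) = universal⇒periodic _ (cone-universal (cycle m 3≤m))
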